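{- Let $\alpha=(\alpha_1,\dots,\alpha_m)$ be a ribbon with $m\ge 3$ and $\alpha_k\ge 2$ for all $k$, and set $\alpha_0=\infty$. Suppose that for some $1\le i\le m-1$ we have $\alpha_i>\alpha_{i+1}$ and $\alpha_i<\alpha_{i-1}+\alpha_{i+1}$. Then $[\alpha]\subseteq[\alpha_{(i\ i+1)}]$.
   Context: A composition $\alpha=(\alpha_1,\dots,\alpha_m)$ determines the ribbon (connected skew shape with no $2\times2$ block) with $m$ rows whose $i$-th row from the top has $\alpha_i$ boxes, the leftmost box of row $i$ lying directly above the rightmost box of row $i+1$. $\alpha_{(i\ i+1)}$ denotes the ribbon whose row-length sequence is $\alpha$ with the $i$-th and $(i+1)$-st entries swapped. For a skew shape $\lambda/\mu$ with Schur expansion $s_{\lambda/\mu}=\sum_\nu c^\lambda_{\mu,\nu}s_\nu$, the Schur support is $[\lambda/\mu]=\{\nu: c^\lambda_{\mu,\nu}>0\}$; by the Littlewood–Richardson rule, $\nu\in[\lambda/\mu]$ iff there is a tableau of shape $\lambda/\mu$ and content $\nu$ that is semistandard (rows weakly increasing, columns strictly increasing) and whose reverse reading word (rows read right to left, top to bottom) is Yamanouchi (every prefix has at least as many $k$'s as $(k+1)$'s for all $k$). -}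

module Defs where

open import Data.Fin.Base using (Fin; zero; suc; inject₁)
import Data.Fin.Base as Fin
open import Data.Fin.Permutation.Components using (transpose)
open import Data.List.Base
  using (List; []; _∷_; length; filter; take; map; concatMap; downFrom; allFin)
open import Data.List.Relation.Unary.All using (All)
open import Data.List.Relation.Unary.Linked using (Linked)
open import Data.Nat.Base using (ℕ; zero; suc; _+_; _∸_; _≤_; _<_; _≥_)
open import Data.Nat.Properties using (_≟_)
open import Data.Product.Base using (_×_; ∃-syntax)
open import Data.Vec.Base using (Vec; []; _∷_; head; lookup; tabulate; zipWith)
open import Level using (0ℓ)
open import Relation.Binary.PropositionalEquality.Core using (_≡_)
open import Relation.Nullary.Construct.Add.Supremum using (_⁺; ⊤⁺; [_])
open import Relation.Binary.Construct.Add.Supremum.Strict _<_ public using (_<⁺_)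
open import Relation.Unary using (Pred)

record Partition : Set where
  field
    parts      : List ℕ
    decreasing : Linked _≥_ parts
    positive   : All (0 <_) parts

-- Entries are indexed from 0, and are 0 beyond the end of the list.
part : List ℕ → ℕ → ℕ
part []       _       = 0
part (p ∷ _)  zero    = p
part (_ ∷ ps) (suc k) = part ps k

-- The skew shape λ/μ with m rows, where outer = λ and inner = μ (padded with
-- zeros): row i, counted from the top, occupies the columns j with μᵢ ≤ j < λᵢ.
record SkewShape (m : ℕ) : Set where
  constructor _/_
  field
    outer : Vec ℕ m
    inner : Vec ℕ m

module _ {m : ℕ} (S : SkewShape m) where
  open SkewShape S

  Cell : Fin m → ℕ → Set
  Cell i j = lookup inner i ≤ j × j < lookup outer i

  -- Only the values on cells matter.  The entry k stands for the positive
  -- integer k + 1, matching the indexing of `part`.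
  Filling : Set
  Filling = Fin m → ℕ → ℕ

  record Semistandard (T : Filling) : Set where
    field
      rows-weak      : ∀ i {j j′} → Cell i j → Cell i j′ → j < j′ → T i j ≤ T i j′
      columns-strict : ∀ {i i′} j → Cell i j → Cell i′ j → i Fin.< i′ → T i j < T i′ j

  -- Rows from top to bottom, each read from right to left.
  reverseReading : Filling → List ℕ
  reverseReading T = concatMap row (allFin m)
    where
    row : Fin m → List ℕ
    row i = map (λ j → T i (lookup inner i + j))
                (downFrom (lookup outer i ∸ lookup inner i))

occurrences : ℕ → List ℕ → ℕ
occurrences k w = length (filter (k ≟_) w)

Yamanouchi : List ℕ → Set
Yamanouchi w = ∀ n k → occurrences (suc k) (take n w) ≤ occurrences k (take n w)

record IsLittlewoodRichardson {m} (S : SkewShape m) (ν : Partition) (T : Filling S) : Set where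
  field
    semistandard : Semistandard S T
    yamanouchi   : Yamanouchi (reverseReading S T)
    content      : ∀ k → occurrences k (reverseReading S T) ≡ part (Partition.parts ν) k

-- The Schur support [λ/μ].  The coefficient of s_ν in the Schur expansion of
-- s_{λ/μ} is the Littlewood–Richardson number c^λ_{μ,ν}, which counts the
-- Littlewood–Richardson tableaux of shape λ/μ and content ν; it is positive
-- exactly when such a tableau exists.
Support : ∀ {m} → SkewShape m → Pred Partition 0ℓ
Support S ν = ∃[ T ] IsLittlewoodRichardson S ν T

-- The bottom row starts in column 0; any other row starts in the last column
-- of the row below it.
ribbonInner : ∀ {m} → Vec ℕ m → Vec ℕ m
ribbonInner []              = []
ribbonInner (_ ∷ [])        = 0 ∷ []
ribbonInner (_ ∷ α@(b ∷ _)) = (head (ribbonInner α) + b ∸ 1) ∷ ribbonInner α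

ribbon : ∀ {m} → Vec ℕ m → SkewShape m
ribbon α = zipWith _+_ (ribbonInner α) α / ribbonInner α

swapAdjacent : ∀ {n} → Fin n → Vec ℕ (suc n) → Vec ℕ (suc n)
swapAdjacent i α = tabulate (λ k → lookup α (transpose (inject₁ i) (suc i) k))

infixl 6 _+⁺_
_+⁺_ : ℕ ⁺ → ℕ → ℕ ⁺
⊤⁺    +⁺ _ = ⊤⁺
[ a ] +⁺ b = [ a + b ]

-- The sequence α₀, α₁, …, αₘ with α₀ = ∞; thus `lookup α k` is the entry at `suc k`.
lookup∞ : ∀ {m} → Vec ℕ m → Fin (suc m) → ℕ ⁺
lookup∞ α zero    = ⊤⁺
lookup∞ α (suc k) = [ lookup α k ]

{-# OPTIONS --safe #-}
-- Reading a Littlewood–Richardson filling of a ribbon row by row adds to a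
-- growing partition, for each row, a horizontal strip: the strip d has d k
-- cells in row k when the row of the ribbon contains k exactly d k times.  The
-- filling exists iff there is a chain of strips of sizes α₁, …, αₘ in which each
-- strip has a cell strictly below some cell of the preceding one.
--
-- Let A, B, C be the strips of rows i-1, i, i+1, of sizes α_(i-1), a, b with
-- a > b.  Cells of B directly above a cell of C cannot move; any other cell of B
-- may be given to C.  Giving a - b of them to C, so that B keeps a cell strictly
-- below some cell of A, exchanges the two sizes.  This fails only if all of C
-- lies directly below cells of B and these cells of B, b in number, are not
-- below any cell of A.  In that case let r be the lowest row containing such a
-- cell.  Then a < α_(i-1) + b says that row r+1 of the shape before B is longer
-- than row r minus α_(i-1), and this lets one move a cell of the shape before B
-- from a row s > r to row r (`promote`), which may alter several earlier strips.
-- The new cell in row r is taken from B, which receives the freed cell in row s.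
module Submission where

open import Defs
open import Data.Bool.Base using (true; false)
open import Data.Fin.Base using (Fin; zero; suc; inject₁)
import Data.Fin.Base as Fin
open import Data.Fin.Permutation.Components using (transpose)
import Data.Fin.Properties as Fin
open import Data.List.Base
  using (List; []; _∷_; _++_; concat; downFrom; filter; length; map; take; tabulate)
open import Data.List.Properties
  using (++-assoc; ++-identityʳ; filter-++; filter-accept; filter-reject;
         length-++; length-downFrom; length-map; map-tabulate)
open import Data.List.Relation.Unary.All using (All; []; _∷_)
open import Data.Nat.Base
  using (ℕ; zero; suc; _+_; _*_; _∸_; _≤_; _<_; z≤n; s≤s; s≤s⁻¹)
open import Data.Nat.Properties
open import Data.Nat.Tactic.RingSolver using (solve-∀)
open import Data.Product.Base using (∃-syntax; ∃₂; _×_; _,_; proj₁; proj₂)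
open import Data.Sum.Base using (_⊎_; inj₁; inj₂)
open import Data.Unit.Base using (⊤; tt)
open import Data.Vec.Base using (Vec; []; _∷_; head; lookup; zipWith)
import Data.Vec.Properties as Vec
open import Function.Base using (_∘_; id)
open import Relation.Binary.Construct.Add.Supremum.Strict _<_ using ([_])
open import Relation.Binary.PropositionalEquality
  using (_≡_; _≢_; refl; sym; trans; cong; cong₂; subst; ≢-sym)
open import Relation.Nullary.Construct.Add.Supremum using (_⁺; ⊤⁺; [_])
open import Relation.Nullary.Decidable using (Dec; does; yes; no; _×-dec_)
open import Relation.Nullary.Negation using (¬_; contradiction)
open import Relation.Unary using (_⊆_)

-- Finite sums and unit vectors.

+-swapʳ : ∀ p q r → (p + q) + r ≡ (p + r) + q
+-swapʳ = solve-∀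

sumBelow : ℕ → (ℕ → ℕ) → ℕ
sumBelow zero    f = 0
sumBelow (suc N) f = sumBelow N f + f N

-- The Kronecker delta: as a function of `k`, `δ i` is a single cell in row `i`. Moves of cells are
-- stated as equations between sums, with `δ` added on both sides, to avoid truncated subtraction.
δ : ℕ → ℕ → ℕ
δ zero    zero    = 1
δ zero    (suc _) = 0
δ (suc _) zero    = 0
δ (suc i) (suc k) = δ i k

δ-same : ∀ i → δ i i ≡ 1
δ-same zero    = refl
δ-same (suc i) = δ-same i

δ-diff : ∀ {i k} → i ≢ k → δ i k ≡ 0
δ-diff {zero}  {zero}  i≢k = contradiction refl i≢k
δ-diff {zero}  {suc k} i≢k = refl
δ-diff {suc i} {zero}  i≢k = refl
δ-diff {suc i} {suc k} i≢k = δ-diff (λ eq → i≢k (cong suc eq))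

δ-fill : ∀ {f g : ℕ → ℕ} {y} → (∀ k → f k ≤ g k) → f y < g y → ∀ k → f k + δ y k ≤ g k
δ-fill {f} {g} {y} f≤g fy<gy k with y ≟ k
... | yes refl rewrite δ-same y | +-comm (f y) 1 = fy<gy
... | no y≢k   rewrite δ-diff y≢k | +-identityʳ (f k) = f≤g k

remove : (ℕ → ℕ) → ℕ → ℕ → ℕ
remove f y k = f k ∸ δ y k

remove-+ : ∀ f {y} → 0 < f y → ∀ k → remove f y k + δ y k ≡ f k
remove-+ f 0<fy k = m∸n+n≡m (δ-fill {λ _ → 0} {f} (λ _ → z≤n) 0<fy k)

remove-≤ : ∀ f y k → remove f y k ≤ f k
remove-≤ f y k = m∸n≤m (f k) (δ y k)

remove-other : ∀ f {y k} → y ≢ k → remove f y k ≡ f k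
remove-other f {y} {k} y≢k = cong (f k ∸_) (δ-diff y≢k)

sumBelow-0 : ∀ N → sumBelow N (λ _ → 0) ≡ 0
sumBelow-0 zero    = refl
sumBelow-0 (suc N) = cong (_+ 0) (sumBelow-0 N)

sumBelow-cong : ∀ N {f g} → (∀ k → f k ≡ g k) → sumBelow N f ≡ sumBelow N g
sumBelow-cong zero    f≡g = refl
sumBelow-cong (suc N) f≡g = cong₂ _+_ (sumBelow-cong N f≡g) (f≡g N)

sumBelow-+ : ∀ N f g → sumBelow N (λ k → f k + g k) ≡ sumBelow N f + sumBelow N g
sumBelow-+ zero    f g = refl
sumBelow-+ (suc N) f g rewrite sumBelow-+ N f g =
  rearrange (sumBelow N f) (sumBelow N g) (f N) (g N)
  where
  rearrange : ∀ p q x y → (p + q) + (x + y) ≡ (p + x) + (q + y)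
  rearrange = solve-∀

sumBelow-mono : ∀ N {f g} → (∀ k → f k ≤ g k) → sumBelow N f ≤ sumBelow N g
sumBelow-mono zero    f≤g = z≤n
sumBelow-mono (suc N) f≤g = +-mono-≤ (sumBelow-mono N f≤g) (f≤g N)

sumBelow-suc : ∀ N f → sumBelow N (λ k → f (suc k)) ≤ sumBelow (suc N) f
sumBelow-suc zero    f = z≤n
sumBelow-suc (suc N) f = +-monoˡ-≤ (f (suc N)) (sumBelow-suc N f)

sumBelow-δ-≥ : ∀ N {i} → N ≤ i → sumBelow N (δ i) ≡ 0
sumBelow-δ-≥ zero    N≤i = refl
sumBelow-δ-≥ (suc N) N<i
  rewrite sumBelow-δ-≥ N (<⇒≤ N<i) = δ-diff (>⇒≢ N<i)

sumBelow-δ : ∀ {N i} → i < N → sumBelow N (δ i) ≡ 1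
sumBelow-δ {suc N} {i} i<1+N with i ≟ N
... | yes refl rewrite sumBelow-δ-≥ N {N} ≤-refl = δ-same N
... | no i≢N
  rewrite sumBelow-δ (≤∧≢⇒< (s≤s⁻¹ i<1+N) i≢N) = cong suc (δ-diff i≢N)

sumBelow-+δ : ∀ {N i} f → i < N → sumBelow N (λ k → f k + δ i k) ≡ suc (sumBelow N f)
sumBelow-+δ {N} {i} f i<N
  rewrite sumBelow-+ N f (δ i) | sumBelow-δ i<N = +-comm (sumBelow N f) 1

term≤sumBelow : ∀ {N k} f → k < N → f k ≤ sumBelow N f
term≤sumBelow {suc N} {k} f k<1+N with k ≟ N
... | yes refl = m≤n+m (f N) (sumBelow N f)
... | no k≢N   =
  ≤-trans (term≤sumBelow f (≤∧≢⇒< (s≤s⁻¹ k<1+N) k≢N)) (m≤m+n (sumBelow N f) (f N))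

two-terms≤sumBelow : ∀ {N j k} f → j < N → k < N → j ≢ k → f j + f k ≤ sumBelow N f
two-terms≤sumBelow {suc N} {j} {k} f j<1+N k<1+N j≢k with j ≟ N | k ≟ N
... | yes refl | yes refl = contradiction refl j≢k
... | yes refl | no k≢N   =
  ≤-trans (≤-reflexive (+-comm (f N) (f k)))
          (+-monoˡ-≤ (f N) (term≤sumBelow f (≤∧≢⇒< (s≤s⁻¹ k<1+N) k≢N)))
... | no j≢N   | yes refl = +-monoˡ-≤ (f N) (term≤sumBelow f (≤∧≢⇒< (s≤s⁻¹ j<1+N) j≢N))
... | no j≢N   | no k≢N   =
  ≤-trans (two-terms≤sumBelow f (≤∧≢⇒< (s≤s⁻¹ j<1+N) j≢N) (≤∧≢⇒< (s≤s⁻¹ k<1+N) k≢N) j≢k)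
          (m≤m+n (sumBelow N f) (f N))

-- The excess of `g` over `f` at one index is at most the total excess.
sumBelow-gap : ∀ {N k} {f g : ℕ → ℕ} → (∀ j → f j ≤ g j) → k < N →
               sumBelow N f + g k ≤ sumBelow N g + f k
sumBelow-gap {suc N} {k} {f} {g} f≤g k<1+N with k ≟ N
... | yes refl = ≤-trans (≤-reflexive (+-swapʳ (sumBelow N f) (f N) (g N)))
                         (+-monoˡ-≤ (f N) (+-monoˡ-≤ (g N) (sumBelow-mono N f≤g)))
... | no k≢N = ≤-trans (≤-reflexive (+-swapʳ (sumBelow N f) (f N) (g k)))
  (≤-trans (+-mono-≤ (sumBelow-gap f≤g (≤∧≢⇒< (s≤s⁻¹ k<1+N) k≢N)) (f≤g N))
           (≤-reflexive (+-swapʳ (sumBelow N g) (f k) (g N))))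

sumBelow-<⇒∃ : ∀ N {f g} → sumBelow N f < sumBelow N g → ∃[ k ] (k < N × f k < g k)
sumBelow-<⇒∃ (suc N) {f} {g} lt with f N <? g N
... | yes fN<gN = N , ≤-refl , fN<gN
... | no  fN≮gN with sumBelow-<⇒∃ N (+-cancelʳ-< (f N) (sumBelow N f) (sumBelow N g)
                      (<-≤-trans lt (+-monoʳ-≤ (sumBelow N g) (≮⇒≥ fN≮gN))))
...   | k , k<N , fk<gk = k , m≤n⇒m≤1+n k<N , fk<gk

last-positive : ∀ N f → 0 < sumBelow N f →
                ∃[ r ] (0 < f r × (∀ k → r < k → k < N → f k ≡ 0))
last-positive (suc N) f pos with 0 <? f N
... | yes 0<fN = N , 0<fN , λ k N<k k<1+N → contradiction N<k (≤⇒≯ (s≤s⁻¹ k<1+N))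
... | no  0≮fN
  with last-positive N f
         (subst (0 <_) (trans (cong (sumBelow N f +_) (n≤0⇒n≡0 (≮⇒≥ 0≮fN))) (+-identityʳ _)) pos)
...   | r , 0<fr , zeros = r , 0<fr , beyond
  where
  beyond : ∀ k → r < k → k < suc N → f k ≡ 0
  beyond k r<k k<1+N with k ≟ N
  ... | yes refl = n≤0⇒n≡0 (≮⇒≥ 0≮fN)
  ... | no k≢N   = zeros k r<k (≤∧≢⇒< (s≤s⁻¹ k<1+N) k≢N)

positive-elsewhere : ∀ N {f} r → f r < sumBelow N f → ∃[ y ] (y ≢ r × 0 < f y)
positive-elsewhere (suc N) {f} r lt with N ≟ r
... | yes refl with sumBelow-<⇒∃ N {λ _ → 0} {f} 0<sum
  where
  0<sum : sumBelow N (λ _ → 0) < sumBelow N f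
  0<sum rewrite sumBelow-0 N = +-cancelʳ-< (f N) 0 (sumBelow N f) lt
...   | y , y<N , 0<fy = y , <⇒≢ y<N , 0<fy
positive-elsewhere (suc N) {f} r lt | no N≢r with f N in eq
... | suc _ = N , N≢r , subst (0 <_) (sym eq) (s≤s z≤n)
... | zero  = positive-elsewhere N r (subst (f r <_) (+-identityʳ _) lt)

-- A discrete intermediate value argument: as long as the sum is below that of `g`, some place has
-- room for one more unit.
interpolate : ∀ N {f g} b → (∀ k → f k ≤ g k) → sumBelow N f ≤ b → b ≤ sumBelow N g →
              ∃[ h ] ((∀ k → f k ≤ h k) × (∀ k → h k ≤ g k) × sumBelow N h ≡ b)
interpolate N {f₀} {g} b f₀≤g Σf₀≤b b≤Σg = go (b ∸ sumBelow N f₀) f₀≤g (m∸n+n≡m Σf₀≤b)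
  where
  -- `c` is the number of units still missing.
  go : ∀ c {f} → (∀ k → f k ≤ g k) → c + sumBelow N f ≡ b →
       ∃[ h ] ((∀ k → f k ≤ h k) × (∀ k → h k ≤ g k) × sumBelow N h ≡ b)
  go zero    {f} f≤g eq = f , (λ _ → ≤-refl) , f≤g , eq
  go (suc c) {f} f≤g refl
    with sumBelow-<⇒∃ N {f} {g} (≤-trans (s≤s (m≤n+m (sumBelow N f) c)) b≤Σg)
  ... | y , y<N , fy<gy
    with go c {λ k → f k + δ y k} (δ-fill f≤g fy<gy)
            (trans (cong (c +_) (sumBelow-+δ f y<N)) (+-suc c (sumBelow N f)))
  ...   | h , f+δ≤h , h≤g , Σh≡b = h , (λ k → m+n≤o⇒m≤o (f k) (f+δ≤h k)) , h≤g , Σh≡b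

-- At most one unit has to be added, and none if `f s` is already positive. It serves to put a
-- prescribed row into a set of cells under construction.
cover : ∀ {N s} {f g : ℕ → ℕ} → (∀ k → f k ≤ g k) → 0 < g s → s < N →
        ∃[ h ] ((∀ k → f k ≤ h k) × (∀ k → h k ≤ g k) × 0 < h s × sumBelow N h ≤ suc (sumBelow N f))
cover {N} {s} {f} {g} f≤g 0<gs s<N with f s in eq
... | suc _ = f , (λ _ → ≤-refl) , f≤g , subst (0 <_) (sym eq) (s≤s z≤n) , n≤1+n _
... | zero  = (λ k → f k + δ s k) , (λ k → m≤m+n (f k) (δ s k))
            , δ-fill f≤g (subst (_< g s) (sym eq) 0<gs)
            , subst (0 <_) (sym (cong₂ _+_ eq (δ-same s))) (s≤s z≤n)
            , ≤-reflexive (sumBelow-+δ f s<N)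

-- Horizontal strips and chains of strips.

After : (ℕ → ℕ) → ℕ → Set
After d s = ∃[ t ] (t < s × 0 < d t)

After? : ∀ d s → Dec (After d s)
After? d s = anyUpTo? (λ t → 0 <? d t) s

-- Shapes are given by their row lengths. The field `strip` says that no column of σ′/σ has two
-- cells. When `Allowed` is `After` of the preceding strip, it is closed under passing to lower
-- rows, so `descent` amounts to the column condition of the ribbon: the rightmost entry of a row
-- exceeds the leftmost entry of the row above.
record Step (N : ℕ) (Allowed : ℕ → Set) (σ : ℕ → ℕ) (a : ℕ) (d σ′ : ℕ → ℕ) : Set where
  field
    grow    : ∀ k → σ′ k ≡ σ k + d k
    strip   : ∀ k → σ′ (suc k) ≤ σ k
    size    : sumBelow N d ≡ a
    bounded : ∀ k → N ≤ k → d k ≡ 0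
    descent : ∃[ s ] (0 < d s × Allowed s)

  inside : ∀ {k} → 0 < d k → k < N
  inside {k} 0<dk = ≰⇒> λ N≤k → contradiction (bounded k N≤k) (>⇒≢ 0<dk)

  below : ∀ k → σ k ≤ σ′ k
  below k = ≤-trans (m≤m+n (σ k) (d k)) (≤-reflexive (sym (grow k)))

open Step

-- The top row of the ribbon has nothing above it, so its descent is unrestricted.
Above : List ℕ → (ℕ → ℕ) → ℕ → Set
Above []      d s = ⊤
Above (_ ∷ _) d s = After d s

Above? : ∀ as d s → Dec (Above as d s)
Above? []      d s = yes tt
Above? (_ ∷ _) d s = After? d s

-- The strips are listed last first, and d is the last one.
Prefix : ℕ → List ℕ → (ℕ → ℕ) → (ℕ → ℕ) → Set
Prefix N []       d σ = ∀ k → σ k ≡ 0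
Prefix N (a ∷ as) d σ = ∃₂ λ d₀ σ₀ → Prefix N as d₀ σ₀ × Step N (Above as d₀) σ₀ a d σ

Prefix-partition : ∀ {N} as {d σ} → Prefix N as d σ → ∀ k → σ (suc k) ≤ σ k
Prefix-partition []       σ≡0 k = ≤-reflexive (trans (σ≡0 (suc k)) (sym (σ≡0 k)))
Prefix-partition (a ∷ as) (_ , _ , _ , st) k = ≤-trans (strip st k) (below st k)

-- Moving a cell of a shape to a higher row.

move-cell : ∀ {N Allowed σ₀ a A A′ σ r y} → Step N Allowed σ₀ a A σ →
            r < y → 0 < A y → (∀ k → suc k ≡ r → σ r < σ₀ k) →
            (∀ k → A′ k + δ y k ≡ A k + δ r k) → (∃[ s ] (0 < A′ s × Allowed s)) →
            0 < A′ r × Step N Allowed σ₀ a A′ (λ k → σ₀ k + A′ k)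
              × (∀ k → (σ₀ k + A′ k) + δ y k ≡ σ k + δ r k)
move-cell {N} {_} {σ₀} {a} {A} {A′} {σ} {r} {y} st r<y 0<Ay room eq desc =
  A′r>0 , record
    { grow    = λ _ → refl
    ; strip   = strip′
    ; size    = suc-injective (trans (sym (sumBelow-+δ A′ y<N))
                  (trans (sumBelow-cong N eq)
                    (trans (sumBelow-+δ A (<-trans r<y y<N)) (cong suc (size st)))))
    ; bounded = λ k N≤k → n≤0⇒n≡0 (≤-trans (m≤m+n (A′ k) (δ y k))
                  (≤-reflexive (trans (eq k) (cong₂ _+_ (bounded st k N≤k)
                    (δ-diff (<⇒≢ (<-≤-trans (<-trans r<y y<N) N≤k)))))))
    ; descent = desc
    } , shape
  where
  y<N : y < N
  y<N = inside st 0<Ay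

  shape : ∀ k → (σ₀ k + A′ k) + δ y k ≡ σ k + δ r k
  shape k = trans (+-assoc (σ₀ k) (A′ k) (δ y k))
    (trans (cong (σ₀ k +_) (eq k))
      (trans (sym (+-assoc (σ₀ k) (A k) (δ r k))) (cong (_+ δ r k) (sym (grow st k)))))

  A′r>0 : 0 < A′ r
  A′r>0 = subst (0 <_)
    (sym (trans (sym (trans (cong (A′ r +_) (δ-diff (>⇒≢ r<y))) (+-identityʳ (A′ r))))
                (trans (eq r) (trans (cong (A r +_) (δ-same r)) (+-comm (A r) 1)))))
    (s≤s z≤n)

  -- Only row `r` gains a cell, and `room` leaves space for it; no other row grows.
  strip′ : ∀ k → σ₀ (suc k) + A′ (suc k) ≤ σ₀ k
  strip′ k with r ≟ suc k
  ... | yes refl = ≤-trans (m≤m+n _ (δ y (suc k)))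
    (≤-trans (≤-reflexive (trans (shape r) (trans (cong (σ r +_) (δ-same r)) (+-comm (σ r) 1)))) (room k refl))
  ... | no r≢1+k = ≤-trans (m≤m+n _ (δ y (suc k)))
    (≤-trans (≤-reflexive (trans (shape (suc k)) (trans (cong (σ (suc k) +_) (δ-diff r≢1+k)) (+-identityʳ _))))
             (strip st k))

-- The demand `0 < A′ r` makes the freed row `s`, which is below `r`, admissible for a cell of the
-- next strip.
Promoted : ℕ → List ℕ → ℕ → (ℕ → ℕ) → Set
Promoted N as r σ = ∃[ s ] ∃₂ λ A′ σ′ → r < s × s < N × Prefix N as A′ σ′ × 0 < A′ r
                                          × (∀ k → σ′ k + δ s k ≡ σ k + δ r k)

-- Induction on the list of strips. The bound `σ r < σ (suc r) + a` forces `A` to have a cell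
-- outside row `r`, hence below it. Such a cell moves up unless this would destroy the only descent
-- of `A`; in that case the preceding strip is treated first.
promote : ∀ {N} a as {A σ} → Prefix N (a ∷ as) A σ → All (2 ≤_) (a ∷ as) →
          ∀ r → (∀ t → t < r → A t ≡ 0) → (∀ k → suc k ≡ r → σ r < σ k) → σ r < σ (suc r) + a →
          Promoted N (a ∷ as) r σ
promote {N} a as {A} {σ} (Z , σ₀ , pre , st) (2≤a ∷ 2≤as) r low room H = main as pre 2≤as st
  where
  Ar<a : A r < a
  Ar<a = +-cancelˡ-< (σ₀ r) (A r) a
    (subst (_< σ₀ r + a) (grow st r) (<-≤-trans H (+-monoˡ-≤ a (strip st r))))

  r<cell : ∀ {y} → y ≢ r → 0 < A y → r < y
  r<cell {y} y≢r 0<Ay =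
    ≤∧≢⇒< (≮⇒≥ λ y<r → contradiction (low y y<r) (>⇒≢ 0<Ay)) (λ r≡y → y≢r (sym r≡y))

  σ≡σ₀ : ∀ k → k < r → σ k ≡ σ₀ k
  σ≡σ₀ k k<r = trans (grow st k) (trans (cong (σ₀ k +_) (low k k<r)) (+-identityʳ (σ₀ k)))

  room₀ : ∀ k → suc k ≡ r → σ r < σ₀ k
  room₀ k refl = subst (σ r <_) (σ≡σ₀ k ≤-refl) (room k refl)

  main : ∀ as → Prefix N as Z σ₀ → All (2 ≤_) as → Step N (Above as Z) σ₀ a A σ →
         Promoted N (a ∷ as) r σ
  main as pre 2≤as st with Above? as Z r
  -- Row `r` is allowed after `Z`, so the new cell in it is a descent and any cell outside row `r`
  -- may be given up.
  ... | yes Zr with positive-elsewhere N {A} r (subst (A r <_) (sym (size st)) Ar<a)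
  ...   | y , y≢r , 0<Ay
    with move-cell {A′ = λ k → remove A y k + δ r k} st (r<cell y≢r 0<Ay) 0<Ay room₀
           (λ k → trans (+-swapʳ (remove A y k) (δ r k) (δ y k)) (cong (_+ δ r k) (remove-+ A 0<Ay k)))
           (r , subst (0 <_) (cong (remove A y r +_) (sym (δ-same r))) (m≤n+m 1 _) , Zr)
  ...     | 0<A′r , st′ , shape =
    y , _ , _ , r<cell y≢r 0<Ay , inside st 0<Ay , (Z , σ₀ , pre , st′) , 0<A′r , shape
  main [] pre 2≤as st | no ¬Zr = contradiction tt ¬Zr
  main (a₁ ∷ as₁) pre 2≤as st | no ¬Zr with descent st
  ... | s₁ , 0<As₁ , Zs₁ = second
    where
    s₁≢r : s₁ ≢ r
    s₁≢r refl = ¬Zr Zs₁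

    r<s₁ : r < s₁
    r<s₁ = r<cell s₁≢r 0<As₁

    -- Row `r` is not allowed, so one allowed cell, in row `s₁`, is held back; `Q` is the rest of
    -- `A`, where another cell to move is sought.
    Q : ℕ → ℕ
    Q = remove A s₁

    Q+δ : ∀ k → Q k + δ s₁ k ≡ A k
    Q+δ = remove-+ A 0<As₁

    Qr≡Ar : Q r ≡ A r
    Qr≡Ar = remove-other A s₁≢r

    ΣQ : suc (sumBelow N Q) ≡ a
    ΣQ = trans (sym (sumBelow-+δ Q (inside st 0<As₁))) (trans (sumBelow-cong N Q+δ) (size st))

    second : Promoted N (a ∷ a₁ ∷ as₁) r σ
    second with Q r <? sumBelow N Q
    second | yes Qr<ΣQ with positive-elsewhere N {Q} r Qr<ΣQ
    ... | y , y≢r , 0<Qy = result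
      where
      0<Ay : 0 < A y
      0<Ay = <-≤-trans 0<Qy (remove-≤ A s₁ y)

      regroup : ∀ p x y z → ((p + x) + y) + z ≡ ((p + z) + x) + y
      regroup = solve-∀

      result : Promoted N (a ∷ a₁ ∷ as₁) r σ
      result
        with move-cell {A′ = λ k → (remove Q y k + δ s₁ k) + δ r k} st (r<cell y≢r 0<Ay) 0<Ay room₀
               (λ k → trans (regroup (remove Q y k) (δ s₁ k) (δ r k) (δ y k))
                        (cong (_+ δ r k) (trans (cong (_+ δ s₁ k) (remove-+ Q 0<Qy k)) (Q+δ k))))
               (s₁ , ≤-trans (≤-trans (≤-reflexive (sym (δ-same s₁))) (m≤n+m _ (remove Q y s₁)))
                             (m≤m+n _ (δ r s₁)) , Zs₁)
      ... | 0<A′r , st′ , shape =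
        y , _ , _ , r<cell y≢r 0<Ay , inside st 0<Ay , (Z , σ₀ , pre , st′) , 0<A′r , shape
    -- A consists of cells of row r and the single cell in row s₁, which A cannot
    -- give up, since no other is allowed after Z.  So the shape before A frees
    -- some row s instead, and A exchanges its cell in row s₁ for one in row s.
    second | no Qr≮ΣQ = result
      where
      r<N : r < N
      r<N = <-trans r<s₁ (inside st 0<As₁)

      Q≡0 : ∀ k → r ≢ k → k < N → Q k ≡ 0
      Q≡0 k r≢k k<N = n≤0⇒n≡0 (+-cancelˡ-≤ (Q r) (Q k) 0
        (≤-trans (two-terms≤sumBelow Q r<N k<N r≢k)
                 (≤-trans (≮⇒≥ Qr≮ΣQ) (≤-reflexive (sym (+-identityʳ (Q r)))))))

      Q≡0′ : ∀ k → r ≢ k → Q k ≡ 0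
      Q≡0′ k r≢k with k <? N
      ... | yes k<N = Q≡0 k r≢k k<N
      ... | no  k≮N = n≤0⇒n≡0 (≤-trans (remove-≤ A s₁ k) (≤-reflexive (bounded st k (≮⇒≥ k≮N))))

      a≤1+Ar : a ≤ suc (A r)
      a≤1+Ar = ≤-trans (≤-reflexive (sym ΣQ)) (s≤s (≤-trans (≮⇒≥ Qr≮ΣQ) (≤-reflexive Qr≡Ar)))

      0<Ar : 0 < A r
      0<Ar = s≤s⁻¹ (≤-trans 2≤a a≤1+Ar)

      δ≤1 : ∀ i k → δ i k ≤ 1
      δ≤1 i k with i ≟ k
      ... | yes refl = ≤-reflexive (δ-same i)
      ... | no  i≢k  = ≤-trans (≤-reflexive (δ-diff i≢k)) z≤n

      A1+r≤1 : A (suc r) ≤ 1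
      A1+r≤1 = ≤-trans (≤-reflexive (sym (Q+δ (suc r))))
        (≤-trans (≤-reflexive (cong (_+ δ s₁ (suc r)) (Q≡0′ (suc r) (<⇒≢ ≤-refl)))) (δ≤1 s₁ (suc r)))

      -- `A` has at most one cell in row `r + 1` and at most one outside row `r`. Passing from `σ`
      -- to `σ₀` therefore leaves the bound with constant 2 in place of `a`, and 2 is at most `a₁`.
      H₀ : σ₀ r < σ₀ (suc r) + a₁
      H₀ = <-≤-trans (+-cancelʳ-< (A r) (σ₀ r) (σ₀ (suc r) + 2)
        (subst (_< σ₀ (suc r) + 2 + A r) (grow st r)
          (<-≤-trans H (≤-trans (+-mono-≤ (≤-trans (≤-reflexive (grow st (suc r))) (+-monoʳ-≤ _ A1+r≤1)) a≤1+Ar)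
            (≤-reflexive (regroup (σ₀ (suc r)) (A r)))))))
        (+-monoʳ-≤ (σ₀ (suc r)) (2≤a₁ 2≤as))
        where
        regroup : ∀ p x → (p + 1) + suc x ≡ (p + 2) + x
        regroup = solve-∀
        2≤a₁ : All (2 ≤_) (a₁ ∷ as₁) → 2 ≤ a₁
        2≤a₁ (p ∷ _) = p

      lowZ : ∀ t → t < r → Z t ≡ 0
      lowZ t t<r = n≤0⇒n≡0 (≮⇒≥ λ 0<Zt → ¬Zr (t , t<r , 0<Zt))

      roomZ : ∀ k → suc k ≡ r → σ₀ r < σ₀ k
      roomZ k eq = ≤-<-trans (below st r) (room₀ k eq)

      result : Promoted N (a ∷ a₁ ∷ as₁) r σ
      result with promote a₁ as₁ pre 2≤as r lowZ roomZ H₀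
      ... | s , Z′ , σ₀′ , r<s , s<N , pre′ , 0<Z′r , shape₀ =
        s₁ , A′ , σ′ , r<s₁ , inside st 0<As₁ , (Z′ , σ₀′ , pre′ , st′)
           , ≤-trans 0<Ar (≤-trans (≤-reflexive (sym Qr≡Ar)) (m≤m+n (Q r) (δ s r))) , shape
        where
        A′ σ′ : ℕ → ℕ
        A′ k = Q k + δ s k
        σ′ k = σ₀′ k + A′ k

        regroup : ∀ p q x → p + (q + x) ≡ (p + x) + q
        regroup = solve-∀

        σ′≡ : ∀ k → σ′ k ≡ (σ₀ k + δ r k) + Q k
        σ′≡ k = trans (regroup (σ₀′ k) (Q k) (δ s k)) (cong (_+ Q k) (shape₀ k))

        regroup′ : ∀ p q x y → ((p + x) + q) + y ≡ (p + (q + y)) + x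
        regroup′ = solve-∀

        shape : ∀ k → σ′ k + δ s₁ k ≡ σ k + δ r k
        shape k = trans (cong (_+ δ s₁ k) (σ′≡ k))
          (trans (regroup′ (σ₀ k) (Q k) (δ r k) (δ s₁ k))
            (cong (_+ δ r k) (trans (cong (σ₀ k +_) (Q+δ k)) (sym (grow st k)))))

        σ₀≤σ₀′ : ∀ k → s ≢ k → σ₀ k ≤ σ₀′ k
        σ₀≤σ₀′ k s≢k = ≤-trans (m≤m+n (σ₀ k) (δ r k)) (≤-reflexive (trans (sym (shape₀ k))
          (trans (cong (σ₀′ k +_) (δ-diff s≢k)) (+-identityʳ _))))

        σ₀′≡σ₀ : ∀ k → r ≢ k → s ≢ k → σ₀ k ≡ σ₀′ k
        σ₀′≡σ₀ k r≢k s≢k = +-cancelʳ-≡ 0 (σ₀ k) (σ₀′ k)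
          (trans (cong (σ₀ k +_) (sym (δ-diff r≢k)))
            (trans (sym (shape₀ k)) (cong (σ₀′ k +_) (δ-diff s≢k))))

        part₀ : ∀ k → σ₀ (suc k) ≤ σ₀ k
        part₀ = Prefix-partition (a₁ ∷ as₁) pre

        -- Since `Q` lives in row `r` alone, the new shape agrees with `σ₀` in every other row.
        strip″ : ∀ k → (σ₀ (suc k) + δ r (suc k)) + Q (suc k) ≤ σ₀′ k
        strip″ k with r ≟ suc k
        ... | yes refl rewrite δ-same r = ≤-trans
          (≤-reflexive (trans (cong ((σ₀ r + 1) +_) Qr≡Ar)
            (trans (cong (_+ A r) (+-comm (σ₀ r) 1)) (cong suc (sym (grow st r))))))
          (≤-trans (room₀ k refl) (σ₀≤σ₀′ k (>⇒≢ (<-trans ≤-refl r<s))))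
        ... | no r≢1+k rewrite δ-diff r≢1+k | Q≡0′ (suc k) r≢1+k
                             | +-identityʳ (σ₀ (suc k) + 0) | +-identityʳ (σ₀ (suc k))
          with s ≟ suc k
        ...   | yes refl = ≤-trans (part₀ k) (σ₀≤σ₀′ k (>⇒≢ ≤-refl))
        ...   | no s≢1+k = ≤-trans (≤-reflexive (σ₀′≡σ₀ (suc k) r≢1+k s≢1+k))
                                   (Prefix-partition (a₁ ∷ as₁) pre′ k)

        st′ : Step N (After Z′) σ₀′ a A′ σ′
        st′ = record
          { grow    = λ _ → refl
          ; strip   = λ k → ≤-trans (≤-reflexive (σ′≡ (suc k))) (strip″ k)
          ; size    = trans (sumBelow-+δ Q s<N) ΣQ
          ; bounded = λ k N≤k → cong₂ _+_ (Q≡0′ k (<⇒≢ (<-≤-trans r<N N≤k)))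
                                          (δ-diff (<⇒≢ (<-≤-trans s<N N≤k)))
          ; descent = s , subst (0 <_) (cong (Q s +_) (sym (δ-same s))) (m≤n+m 1 _) , r , r<s , 0<Z′r
          }

-- Exchanging the sizes of two consecutive strips.

absorb : ∀ {N Allowed σ a b B C τ ρ X Y} → Step N Allowed σ a B τ → Step N (After B) τ b C ρ →
         (∀ k → ρ (suc k) ≤ σ k + X k) → (∀ k → X k ≤ B k) → sumBelow N X ≡ b →
         (∃[ u ] (0 < C u × After Y u)) →
         Step N (After Y) (λ k → σ k + X k) a (λ k → C k + (B k ∸ X k)) ρ
absorb {N} {_} {σ} {a} {b} {B} {C} {τ} {ρ} {X} {Y} stB stC strip′ X≤B ΣX (u , 0<Cu , Yu) = record
  -- The cells of `B` outside `X` pass to the second strip, so the final shape stays `ρ` and the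
  -- second size becomes b + a - b. The descent refers to a separate `Y`, because the first strip is
  -- not `X` itself when the shape before it has changed.
  { grow    = λ k → trans (grow stC k) (trans (cong (_+ C k) (trans (grow stB k)
                (cong (σ k +_) (sym (m∸n+n≡m (X≤B k)))))) (regroup (σ k) (B k ∸ X k) (X k) (C k)))
  ; strip   = strip′
  ; size    = +-cancelʳ-≡ b _ a
      (trans (cong (sumBelow N (λ k → C k + (B k ∸ X k)) +_) (sym ΣX))
        (trans (sym (sumBelow-+ N _ X))
          (trans (sumBelow-cong N (λ k → trans (+-assoc (C k) (B k ∸ X k) (X k))
                                               (cong (C k +_) (m∸n+n≡m (X≤B k)))))
            (trans (sumBelow-+ N C B) (trans (cong₂ _+_ (size stC) (size stB)) (+-comm b a))))))
  ; bounded = λ k N≤k → cong₂ _+_ (bounded stC k N≤k)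
                          (n≤0⇒n≡0 (≤-trans (m∸n≤m (B k) (X k)) (≤-reflexive (bounded stB k N≤k))))
  ; descent = u , <-≤-trans 0<Cu (m≤m+n (C u) _) , Yu
  }
  where
  regroup : ∀ p q x y → (p + (q + x)) + y ≡ (p + x) + (y + q)
  regroup = solve-∀

previous : List ℕ → ℕ ⁺
previous []      = ⊤⁺
previous (a ∷ _) = [ a ]

-- The final shape `ρ` is kept and the last strip only grows, so whatever was allowed after `C` is
-- allowed after `C′` and the rest of the chain remains valid.
Exchanged : ℕ → List ℕ → ℕ → ℕ → (ℕ → ℕ) → (ℕ → ℕ) → Set
Exchanged N as a b C ρ = ∃₂ λ A′ σ′ → ∃₂ λ B′ τ′ → ∃[ C′ ]
  (Prefix N as A′ σ′ × Step N (Above as A′) σ′ b B′ τ′ × Step N (After B′) τ′ a C′ ρ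
    × (∀ k → C k ≤ C′ k))

exchange : ∀ {N as A σ a b B C τ ρ} → Prefix N as A σ → All (2 ≤_) as → 2 ≤ b → b < a →
           [ a ] <⁺ previous as +⁺ b →
           Step N (Above as A) σ a B τ → Step N (After B) τ b C ρ →
           Exchanged N as a b C ρ
exchange {N} {as} {A} {σ} {a} {b} {B} {C} {τ} {ρ} pre 2≤as 2≤b b<a short stB stC = main
  where
  -- The cells of row k of the strip B that have a cell of C directly below
  -- them: these columns have length two, so their cells cannot move.
  M : ℕ → ℕ
  M k = ρ (suc k) ∸ σ k

  M≤B : ∀ k → M k ≤ B k
  M≤B k = m≤n+o⇒m∸n≤o (ρ (suc k)) (σ k) (≤-trans (strip stC k) (≤-reflexive (grow stB k)))

  M≤C : ∀ k → M k ≤ C (suc k)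
  M≤C k = m≤n+o⇒m∸n≤o (ρ (suc k)) (σ k)
    (≤-trans (≤-reflexive (grow stC (suc k))) (+-monoˡ-≤ (C (suc k)) (strip stB k)))

  ΣC≤b : sumBelow N (λ k → C (suc k)) ≤ b
  ΣC≤b = ≤-trans (sumBelow-suc N C)
    (≤-reflexive (trans (cong (sumBelow N C +_) (bounded stC N ≤-refl))
                        (trans (+-identityʳ _) (size stC))))

  ΣM≤b : sumBelow N M ≤ b
  ΣM≤b = ≤-trans (sumBelow-mono N M≤C) ΣC≤b

  -- The earlier strips can stay as they are: `M ≤ X` is what the strip condition of the second step
  -- needs, and `X ≤ B` gives that of the first.
  local : ∀ {X} → (∀ k → M k ≤ X k) → (∀ k → X k ≤ B k) → sumBelow N X ≡ b →
          (∃[ s ] (0 < X s × Above as A s)) → (∃[ u ] (0 < C u × After X u)) →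
          Exchanged N as a b C ρ
  local {X} M≤X X≤B ΣX desc descC =
    A , σ , X , _ , _ , pre , record
      { grow    = λ _ → refl
      ; strip   = λ k → ≤-trans (+-monoʳ-≤ (σ (suc k)) (X≤B (suc k)))
                          (≤-trans (≤-reflexive (sym (grow stB (suc k)))) (strip stB k))
      ; size    = ΣX
      ; bounded = λ k N≤k → n≤0⇒n≡0 (≤-trans (X≤B k) (≤-reflexive (bounded stB k N≤k)))
      ; descent = desc
      } , absorb stB stC
            (λ k → ≤-trans (m≤n+m∸n (ρ (suc k)) (σ k)) (+-monoʳ-≤ (σ k) (M≤X k)))
            X≤B ΣX descC
      , λ k → m≤m+n (C k) _

  b≤ΣB : b ≤ sumBelow N B
  b≤ΣB = ≤-trans (<⇒≤ b<a) (≤-reflexive (sym (size stB)))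

  -- The cells that must stay for the sake of the descent of the second strip. If `M` is nonzero it
  -- suffices, as a cell of `C` lies directly below it; otherwise one cell of `B` above some cell of
  -- `C` is added.
  low-cover : ∃[ h ] ((∀ k → M k ≤ h k) × (∀ k → h k ≤ B k) ×
                (∃[ u ] (0 < C u × After h u)) × (sumBelow N h ≤ sumBelow N M ⊎ sumBelow N h ≤ 1))
  low-cover with sumBelow N M in eq
  low-cover | zero with descent stC
  ... | u , 0<Cu , t , t<u , 0<Bt with cover {N} M≤B 0<Bt (inside stB 0<Bt)
  ...   | h , M≤h , h≤B , 0<ht , Σh = h , M≤h , h≤B , (u , 0<Cu , t , t<u , 0<ht)
        , inj₂ (≤-trans Σh (s≤s (≤-reflexive eq)))
  low-cover | suc n with last-positive N M (subst (0 <_) (sym eq) (s≤s z≤n))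
  ... | r , 0<Mr , _ = M , (λ _ → ≤-refl) , M≤B
        , (suc r , <-≤-trans 0<Mr (M≤C r) , r , ≤-refl , 0<Mr) , inj₁ (≤-reflexive eq)

  main : Exchanged N as a b C ρ
  main with sumBelow N M <? b
  -- Because of `ΣM < b` and `2 ≤ b`, one further cell fits: a descent of `B`. The remaining places
  -- up to `b` are filled arbitrarily.
  main | yes ΣM<b with low-cover | descent stB
  ... | h , M≤h , h≤B , (u , 0<Cu , t , t<u , 0<ht) , Σh | s , 0<Bs , As
    with cover {N} h≤B 0<Bs (inside stB 0<Bs)
  ...   | h′ , h≤h′ , h′≤B , 0<h′s , Σh′ with interpolate N b h′≤B (≤-trans Σh′ (bound Σh)) b≤ΣB
    where
    bound : ∀ {n} → n ≤ sumBelow N M ⊎ n ≤ 1 → suc n ≤ b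
    bound (inj₁ n≤ΣM) = ≤-<-trans n≤ΣM ΣM<b
    bound (inj₂ n≤1)  = ≤-trans (s≤s n≤1) 2≤b
  ...     | X , h′≤X , X≤B , ΣX =
    local (λ k → ≤-trans (M≤h k) (≤-trans (h≤h′ k) (h′≤X k))) X≤B ΣX
      (s , <-≤-trans 0<h′s (h′≤X s) , As)
      (u , 0<Cu , t , t<u , <-≤-trans 0<ht (≤-trans (h≤h′ t) (h′≤X t)))
  -- Now `M` has exactly `b` cells, so `X` can only be `M`; this works if some cell of `M` is
  -- allowed.
  main | no ΣM≮b with anyUpTo? (λ k → (0 <? M k) ×-dec Above? as A k) N
  ... | yes (k , _ , 0<Mk , Ak) =
    local (λ _ → ≤-refl) M≤B (≤-antisym ΣM≤b (≮⇒≥ ΣM≮b)) (k , 0<Mk , Ak)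
      (suc k , <-≤-trans 0<Mk (M≤C k) , k , ≤-refl , 0<Mk)
  ... | no none = hard as pre 2≤as short none
    where
    ΣM≡b : sumBelow N M ≡ b
    ΣM≡b = ≤-antisym ΣM≤b (≮⇒≥ ΣM≮b)

    hard : ∀ as → Prefix N as A σ → All (2 ≤_) as → [ a ] <⁺ previous as +⁺ b →
           ¬ (∃[ k ] (k < N × 0 < M k × Above as A k)) →
           Exchanged N as a b C ρ
    hard as pre 2≤as short none
      with last-positive N M (subst (0 <_) (sym ΣM≡b) (<-trans (s≤s z≤n) 2≤b))
    hard [] pre 2≤as short none | r , 0<Mr , _ =
      contradiction (r , inside stB (<-≤-trans 0<Mr (M≤B r)) , 0<Mr , tt) none
    hard (a₀ ∷ as₀) pre 2≤as [ a<a₀+b ] none | r , 0<Mr , beyond = result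
      where
      r<N : r < N
      r<N = inside stB (<-≤-trans 0<Mr (M≤B r))

      Mabove : ∀ k → r < k → M k ≡ 0
      Mabove k r<k with k <? N
      ... | yes k<N = beyond k r<k k<N
      ... | no  k≮N = n≤0⇒n≡0 (≤-trans (M≤B k) (≤-reflexive (bounded stB k (≮⇒≥ k≮N))))

      low : ∀ t → t < r → A t ≡ 0
      low t t<r = n≤0⇒n≡0 (≮⇒≥ λ 0<At → none (r , r<N , 0<Mr , t , t<r , 0<At))

      room : ∀ k → suc k ≡ r → σ r < σ k
      room k refl = <-≤-trans
        (subst (σ r <_) (sym (grow stB r)) (m<m+n (σ r) (<-≤-trans 0<Mr (M≤B r)))) (strip stB k)

      -- `M` vanishes in row `r + 1`, so the cells of `B` there are among its a - b unmatched ones.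
      B1+r : B (suc r) + b ≤ a
      B1+r with suc r <? N
      ... | yes 1+r<N = ≤-trans (≤-reflexive (trans (+-comm _ b) (cong (_+ B (suc r)) (sym ΣM≡b))))
        (≤-trans (sumBelow-gap M≤B 1+r<N) (≤-reflexive (trans
          (cong₂ _+_ (size stB) (Mabove (suc r) ≤-refl)) (+-identityʳ a))))
      ... | no  1+r≮N rewrite bounded stB (suc r) (≮⇒≥ 1+r≮N) = <⇒≤ b<a

      -- As ΣM ≡ b ≡ ΣC, every cell of C is matched, so B fills row r + 1 up to
      -- the length of row r of σ; none of the cells used for this is matched.
      C1+r : C (suc r) ≤ M r
      C1+r = +-cancelˡ-≤ b _ _ (≤-trans (≤-reflexive (cong (_+ C (suc r)) (sym ΣM≡b)))
        (≤-trans (sumBelow-gap {N} M≤C r<N) (+-monoˡ-≤ (M r) ΣC≤b)))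

      σ≤τ : σ r ≤ σ (suc r) + B (suc r)
      σ≤τ = subst (σ r ≤_) (grow stB (suc r)) (+-cancelʳ-≤ (C (suc r)) (σ r) (τ (suc r))
        (≤-trans (+-monoʳ-≤ (σ r) C1+r) (≤-reflexive (trans
          (m+[n∸m]≡n {σ r} (<⇒≤ (m∸n≢0⇒n<m (>⇒≢ 0<Mr)))) (grow stC (suc r))))))

      -- Here the hypothesis `a < a₀ + b` enters, through B (suc r) ≤ a - b < a₀.
      H : σ r < σ (suc r) + a₀
      H = ≤-<-trans σ≤τ (+-monoʳ-< (σ (suc r)) (+-cancelʳ-< b _ _ (≤-<-trans B1+r a<a₀+b)))

      result : Exchanged N (a₀ ∷ as₀) a b C ρ
      result with promote a₀ as₀ pre 2≤as r low room H
      ... | s , A′ , σ′ , r<s , s<N , pre′ , 0<A′r , shape =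
        A′ , σ′ , B′ , (λ k → σ k + M k) , _ , pre′ , stB′ , stC′ , (λ k → m≤m+n (C k) _)
        where
        -- Promotion has already put a cell into row `r`, so one cell of `M` there is traded for the
        -- one freed in row `s`; the shape after this strip is still `σ + M`.
        B′ : ℕ → ℕ
        B′ k = remove M r k + δ s k

        grow′ : ∀ k → σ k + M k ≡ σ′ k + B′ k
        grow′ k = trans (cong (σ k +_) (sym (remove-+ M 0<Mr k)))
          (trans (regroup (σ k) (remove M r k) (δ r k))
            (trans (cong (_+ remove M r k) (sym (shape k))) (sym (regroup (σ′ k) (remove M r k) (δ s k)))))
          where
          regroup : ∀ p q x → p + (q + x) ≡ (p + x) + q
          regroup = solve-∀

        part′ : ∀ k → σ′ (suc k) ≤ σ′ k
        part′ = Prefix-partition (a₀ ∷ as₀) pre′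

        strip′ : ∀ k → σ (suc k) + M (suc k) ≤ σ′ k
        strip′ k with s ≟ k
        -- Row `s` has lost a cell, but row `s + 1` is below `r`, so `M` vanishes there and the
        -- claim is that `σ′` is a partition.
        ... | yes refl rewrite Mabove (suc s) (m<n⇒m<1+n r<s) = ≤-trans
          (≤-reflexive (cong (σ (suc s) +_) (sym (δ-diff (<⇒≢ (m<n⇒m<1+n r<s))))))
          (≤-trans (≤-reflexive (trans (sym (shape (suc s)))
            (trans (cong (σ′ (suc s) +_) (δ-diff (<⇒≢ (n<1+n s)))) (+-identityʳ _)))) (part′ s))
        ... | no s≢k = ≤-trans (+-monoʳ-≤ (σ (suc k)) (M≤B (suc k)))
          (≤-trans (≤-reflexive (sym (grow stB (suc k)))) (≤-trans (strip stB k)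
            (≤-trans (m≤m+n (σ k) (δ r k)) (≤-reflexive (trans (sym (shape k))
              (trans (cong (σ′ k +_) (δ-diff s≢k)) (+-identityʳ _)))))))

        ΣM-r : suc (sumBelow N (remove M r)) ≡ b
        ΣM-r = trans (sym (sumBelow-+δ (remove M r) r<N))
                     (trans (sumBelow-cong N (remove-+ M 0<Mr)) ΣM≡b)

        stB′ : Step N (After A′) σ′ b B′ (λ k → σ k + M k)
        stB′ = record
          { grow    = grow′
          ; strip   = strip′
          ; size    = trans (sumBelow-+δ (remove M r) s<N) ΣM-r
          ; bounded = λ k N≤k → cong₂ _+_
              (n≤0⇒n≡0 (≤-trans (remove-≤ M r k) (≤-trans (M≤B k) (≤-reflexive (bounded stB k N≤k)))))
              (δ-diff (<⇒≢ (<-≤-trans s<N N≤k)))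
          ; descent = s , subst (0 <_) (cong (remove M r s +_) (sym (δ-same s))) (m≤n+m 1 _)
                        , r , r<s , 0<A′r
          }

        descC′ : ∃[ u ] (0 < C u × After B′ u)
        -- As `b` is at least 2, a cell of `M` remains after the trade, with a cell of `C` directly
        -- below it.
        descC′ with last-positive N (remove M r) (s≤s⁻¹ (subst (2 ≤_) (sym ΣM-r) 2≤b))
        ... | t , 0<Mt , _ =
          suc t , <-≤-trans 0<Mt (≤-trans (remove-≤ M r t) (M≤C t))
                , t , ≤-refl , <-≤-trans 0<Mt (m≤m+n _ (δ s t))

        stC′ : Step N (After B′) (λ k → σ k + M k) a (λ k → C k + (B k ∸ M k)) ρ
        stC′ = absorb stB stC (λ k → m≤n+m∸n (ρ (suc k)) (σ k)) M≤B ΣM≡b descC′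

-- Chains and the swap of adjacent sizes.

Chain : ∀ {m} → ℕ → (ℕ → Set) → (ℕ → ℕ) → Vec ℕ m → (ℕ → ℕ) → Set
Chain N Allowed σ []      ν = ∀ k → σ k ≡ ν k
Chain N Allowed σ (a ∷ α) ν = ∃₂ λ d σ′ → Step N Allowed σ a d σ′ × Chain N (After d) σ′ α ν

Chain-mono : ∀ {m N σ ν} {Allowed Allowed′ : ℕ → Set} (α : Vec ℕ m) → Allowed ⊆ Allowed′ →
             Chain N Allowed σ α ν → Chain N Allowed′ σ α ν
Chain-mono []      sub end = end
Chain-mono (a ∷ α) sub (d , σ′ , st , chain) with descent st
... | s , 0<ds , allowed = d , σ′ , record
  { grow = grow st ; strip = strip st ; size = size st ; bounded = bounded st
  ; descent = s , 0<ds , sub allowed } , chain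

transpose-suc : ∀ {n} (i j k : Fin n) → transpose (suc i) (suc j) (suc k) ≡ suc (transpose i j k)
transpose-suc i j k with does (k Fin.≟ i)
... | true = refl
... | false with does (k Fin.≟ j)
...   | true  = refl
...   | false = refl

swapAdjacent-zero : ∀ {n} a b (α : Vec ℕ n) → swapAdjacent zero (a ∷ b ∷ α) ≡ b ∷ a ∷ α
swapAdjacent-zero a b α = cong (λ v → b ∷ a ∷ v) (Vec.tabulate∘lookup α)

swapAdjacent-suc : ∀ {n} i a (α : Vec ℕ (suc n)) → swapAdjacent (suc i) (a ∷ α) ≡ a ∷ swapAdjacent i α
swapAdjacent-suc i a α =
  cong (a ∷_) (Vec.tabulate-cong λ k → cong (lookup (a ∷ α)) (transpose-suc (inject₁ i) (suc i) k))

-- Generalises `lookup∞` to any initial value, so that in the recursion the size of the last strip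
-- passed can replace ∞.
lookupAfter : ∀ {m} → ℕ ⁺ → Vec ℕ m → Fin (suc m) → ℕ ⁺
lookupAfter p α zero    = p
lookupAfter p α (suc k) = [ lookup α k ]

-- `Prefix` and `Chain` form a zipper: the recursion on `i` shifts strips to the prefix until
-- `exchange` applies, and then shifts back the strips it returns, which may be new ones.
swap-chain : ∀ {N n ν} as {d σ} → Prefix N as d σ → All (2 ≤_) as →
             (α : Vec ℕ (suc n)) → (∀ k → 2 ≤ lookup α k) → (i : Fin n) →
             lookup α (suc i) < lookup α (inject₁ i) →
             [ lookup α (inject₁ i) ]
               <⁺ lookupAfter (previous as) α (inject₁ (inject₁ i)) +⁺ lookup α (suc i) →
             Chain N (Above as d) σ α ν →
             ∃₂ λ d′ σ′ → Prefix N as d′ σ′ × Chain N (Above as d′) σ′ (swapAdjacent i α) ν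
swap-chain {N} {ν = ν} as pre 2≤as (a ∷ b ∷ α) 2≤α zero b<a short (B , τ , stB , C , ρ , stC , chain)
  with exchange {as = as} pre 2≤as (2≤α (suc zero)) b<a short stB stC
... | A′ , σ′ , B′ , τ′ , C′ , pre′ , stB′ , stC′ , C≤C′ =
  A′ , σ′ , pre′ , subst (λ β → Chain N (Above as A′) σ′ β ν) (sym (swapAdjacent-zero a b α))
    (B′ , τ′ , stB′ , C′ , ρ , stC′
        , Chain-mono α (λ (t , t<s , 0<Ct) → t , t<s , <-≤-trans 0<Ct (C≤C′ t)) chain)
swap-chain {N} {ν = ν} as {d} {σ} pre 2≤as (a ∷ α) 2≤α (suc i) desc short (A , τ , stA , chain)
  with swap-chain (a ∷ as) (d , σ , pre , stA) (2≤α zero ∷ 2≤as) α (2≤α ∘ suc) i desc (short′ i α short) chain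
  where
  short′ : ∀ {n} (i : Fin n) (α : Vec ℕ (suc n)) →
    [ lookup α (inject₁ i) ] <⁺ [ lookup (a ∷ α) (inject₁ (inject₁ i)) ] +⁺ lookup α (suc i) →
    [ lookup α (inject₁ i) ] <⁺ lookupAfter [ a ] α (inject₁ (inject₁ i)) +⁺ lookup α (suc i)
  short′ zero    α p = p
  short′ (suc i) α p = p
... | A′ , τ′ , (d′ , σ′ , pre′ , stA′) , chain′ =
  d′ , σ′ , pre′ , subst (λ β → Chain N (Above as d′) σ′ β ν) (sym (swapAdjacent-suc i a α)) (A′ , τ′ , stA′ , chain′)

-- Occurrences in words and the Yamanouchi condition.

occurrences-++ : ∀ k u v → occurrences k (u ++ v) ≡ occurrences k u + occurrences k v
occurrences-++ k u v = trans (cong length (filter-++ (k ≟_) u v)) (length-++ (filter (k ≟_) u))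

occurrences-∷ : ∀ k x w → occurrences k (x ∷ w) ≡ δ x k + occurrences k w
occurrences-∷ k x w with k ≟ x
... | yes refl = trans (cong length (filter-accept (k ≟_) refl))
                      (cong (_+ occurrences k w) (sym (δ-same k)))
... | no  k≢x  = trans (cong length (filter-reject (k ≟_) k≢x))
                      (cong (_+ occurrences k w) (sym (δ-diff (≢-sym k≢x))))

rowWord : (ℕ → ℕ) → ℕ → List ℕ
rowWord f a = map f (downFrom a)

length-rowWord : ∀ f a → length (rowWord f a) ≡ a
length-rowWord f a = trans (length-map f (downFrom a)) (length-downFrom a)

reverseReading-∷ : ∀ {m} x a (c α : Vec ℕ m) (T : Fin (suc m) → ℕ → ℕ) →
  reverseReading (zipWith _+_ (x ∷ c) (a ∷ α) / (x ∷ c)) T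
    ≡ rowWord (λ j → T zero (x + j)) a ++ reverseReading (zipWith _+_ c α / c) (T ∘ suc)
reverseReading-∷ {m} x a c α T = cong₂ _++_
  (cong (rowWord (λ j → T zero (x + j))) (m+n∸m≡n x a))
  (cong concat (trans (map-tabulate {n = m} Fin.suc _) (sym (map-tabulate {n = m} id _))))

occurrences-none : ∀ {k} f a → (∀ t → t < a → k ≢ f t) → occurrences k (rowWord f a) ≡ 0
occurrences-none         f zero    none = refl
occurrences-none {k} f (suc a) none
  rewrite occurrences-∷ k (f a) (rowWord f a) | δ-diff (≢-sym (none a ≤-refl)) =
  occurrences-none f a (λ t t<a → none t (m≤n⇒m≤1+n t<a))

occurrences-some : ∀ {t} f a → t < a → 0 < occurrences (f t) (rowWord f a)
occurrences-some {t} f (suc a) t<1+a rewrite occurrences-∷ (f t) (f a) (rowWord f a) with t ≟ a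
... | yes refl rewrite δ-same (f a) = s≤s z≤n
... | no t≢a   =
  ≤-trans (occurrences-some f a (≤∧≢⇒< (s≤s⁻¹ t<1+a) t≢a)) (m≤n+m _ (δ (f a) (f t)))

occurrences-position : ∀ {k} f a → 0 < occurrences k (rowWord f a) → ∃[ t ] (t < a × f t ≡ k)
occurrences-position {k} f (suc a) pos rewrite occurrences-∷ k (f a) (rowWord f a) with f a ≟ k
... | yes fa≡k = a , ≤-refl , fa≡k
... | no  fa≢k rewrite δ-diff fa≢k with occurrences-position f a pos
...   | t , t<a , ft≡k = t , m≤n⇒m≤1+n t<a , ft≡k

sumBelow-occurrences : ∀ N w → (∀ k → N ≤ k → occurrences k w ≡ 0) →
                       sumBelow N (λ k → occurrences k w) ≡ length w
sumBelow-occurrences N []      out = sumBelow-0 N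
sumBelow-occurrences N (x ∷ w) out =
  trans (sumBelow-cong N (λ k → trans (occurrences-∷ k x w) (+-comm (δ x k) _)))
    (trans (sumBelow-+δ (λ k → occurrences k w) x<N)
      (cong suc (sumBelow-occurrences N w λ k N≤k →
        m+n≡0⇒n≡0 (δ x k) (trans (sym (occurrences-∷ k x w)) (out k N≤k)))))
  where
  x<N : x < N
  x<N = ≰⇒> λ N≤x → contradiction
    (m+n≡0⇒m≡0 (δ x x) (trans (sym (occurrences-∷ x x w)) (out x N≤x)))
    (λ δ≡0 → contradiction (trans (sym (δ-same x)) δ≡0) λ ())

take-length-++ : ∀ (u v : List ℕ) → take (length u) (u ++ v) ≡ u
take-length-++ []      v = refl
take-length-++ (x ∷ u) v = cong (x ∷_) (take-length-++ u v)

Yamanouchi-prefix : ∀ u v → Yamanouchi (u ++ v) → ∀ k → occurrences (suc k) u ≤ occurrences k u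
Yamanouchi-prefix u v yam k =
  subst (λ w → occurrences (suc k) w ≤ occurrences k w) (take-length-++ u v) (yam (length u) k)

take-++-cases : ∀ (u v : List ℕ) n →
  take n (u ++ v) ≡ take n u ⊎ ∃[ n′ ] take n (u ++ v) ≡ u ++ take n′ v
take-++-cases []      v n       = inj₂ (n , refl)
take-++-cases (x ∷ u) v zero    = inj₁ refl
take-++-cases (x ∷ u) v (suc n) with take-++-cases u v n
... | inj₁ eq        = inj₁ (cong (x ∷_) eq)
... | inj₂ (n′ , eq) = inj₂ (n′ , cong (x ∷_) eq)

-- The bound covers the worst case, in which every `k + 1` of `v` is read before any `k` of `v`.
Yamanouchi-++ : ∀ u v → Yamanouchi u →
  (∀ k → occurrences (suc k) u + occurrences (suc k) v ≤ occurrences k u) → Yamanouchi (u ++ v)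
Yamanouchi-++ u v yam bound n k with take-++-cases u v n
... | inj₁ eq rewrite eq = yam n k
... | inj₂ (n′ , eq) rewrite eq | occurrences-++ (suc k) u (take n′ v) | occurrences-++ k u (take n′ v) =
  ≤-trans (+-monoʳ-≤ (occurrences (suc k) u) (take-≤ v n′))
          (≤-trans (bound k) (m≤m+n (occurrences k u) _))
  where
  take-≤ : ∀ v n → occurrences (suc k) (take n v) ≤ occurrences (suc k) v
  take-≤ v       zero    = z≤n
  take-≤ []      (suc n) = z≤n
  take-≤ (x ∷ v) (suc n)
    rewrite occurrences-∷ (suc k) x (take n v) | occurrences-∷ (suc k) x v = +-monoʳ-≤ (δ x (suc k)) (take-≤ v n)

-- Read from the right, the row is weakly decreasing: the entries above `c` come first, then those
-- at most `c`.
row-split : ∀ f a c → (∀ {t u} → t < u → u < a → f t ≤ f u) →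
  ∃₂ λ u v → rowWord f a ≡ u ++ v × occurrences c u ≡ 0 × occurrences (suc c) v ≡ 0
row-split f zero    c mono = [] , [] , refl , refl , refl
row-split f (suc a) c mono with c <? f a
... | no c≮fa = [] , rowWord f (suc a) , refl , refl
  , occurrences-none f (suc a) λ t t<1+a 1+c≡ft → c≮fa (≤-trans (≤-reflexive 1+c≡ft) (≤fa t t<1+a))
  where
  ≤fa : ∀ t → t < suc a → f t ≤ f a
  ≤fa t t<1+a with t ≟ a
  ... | yes refl = ≤-refl
  ... | no  t≢a  = mono (≤∧≢⇒< (s≤s⁻¹ t<1+a) t≢a) ≤-refl
... | yes c<fa with row-split f a c (λ t<u u<a → mono t<u (m≤n⇒m≤1+n u<a))
...   | u , v , eq , none-u , none-v = f a ∷ u , v , cong (f a ∷_) eq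
  , trans (occurrences-∷ c (f a) u) (cong₂ _+_ (δ-diff (>⇒≢ c<fa)) none-u) , none-v

-- From fillings to chains.

step-of-row : ∀ {N Allowed w} pre f a rest → w ≡ pre ++ (rowWord f (suc a) ++ rest) →
  (∀ {t u} → t < u → u < suc a → f t ≤ f u) → Yamanouchi w →
  (∀ k → N ≤ k → occurrences k w ≡ 0) → Allowed (f a) →
  Step N Allowed (λ k → occurrences k pre) (suc a)
    (λ k → occurrences k (rowWord f (suc a))) (λ k → occurrences k (pre ++ rowWord f (suc a)))
step-of-row {N} pre f a rest refl mono yam out allowed = record
  { grow    = λ k → occurrences-++ k pre row
  ; strip   = strip′
  ; size    = trans (sumBelow-occurrences N row out′) (length-rowWord f (suc a))
  ; bounded = out′
  -- The rightmost box is the one that lies under the row above.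
  ; descent = f a , occurrences-some f (suc a) ≤-refl , allowed
  }
  where
  row : List ℕ
  row = rowWord f (suc a)

  out′ : ∀ k → N ≤ k → occurrences k row ≡ 0
  out′ k N≤k = m+n≡0⇒m≡0 (occurrences k row) (trans (sym (occurrences-++ k row rest))
    (m+n≡0⇒n≡0 (occurrences k pre) (trans (sym (occurrences-++ k pre (row ++ rest))) (out k N≤k))))

  -- All entries above k of the row are read before its first k: at that
  -- moment the Yamanouchi condition is the strip condition.
  strip′ : ∀ k → occurrences (suc k) (pre ++ row) ≤ occurrences k pre
  strip′ k with row-split f (suc a) k mono
  ... | u , v , eq , none-u , none-v = begin
    occurrences (suc k) (pre ++ row)        ≡⟨ cong (λ w → occurrences (suc k) (pre ++ w)) eq ⟩
    occurrences (suc k) (pre ++ (u ++ v))   ≡⟨ cong (occurrences (suc k)) (++-assoc pre u v) ⟨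
    occurrences (suc k) ((pre ++ u) ++ v)   ≡⟨ occurrences-++ (suc k) (pre ++ u) v ⟩
    occurrences (suc k) (pre ++ u) + occurrences (suc k) v
                                            ≡⟨ cong (occurrences (suc k) (pre ++ u) +_) none-v ⟩
    occurrences (suc k) (pre ++ u) + 0      ≡⟨ +-identityʳ _ ⟩
    occurrences (suc k) (pre ++ u)          ≤⟨ Yamanouchi-prefix (pre ++ u) (v ++ rest) (subst Yamanouchi word yam) k ⟩
    occurrences k (pre ++ u)                ≡⟨ occurrences-++ k pre u ⟩
    occurrences k pre + occurrences k u     ≡⟨ cong (occurrences k pre +_) none-u ⟩
    occurrences k pre + 0                   ≡⟨ +-identityʳ _ ⟩
    occurrences k pre                       ∎
    where
    open ≤-Reasoning
    word : pre ++ (row ++ rest) ≡ (pre ++ u) ++ (v ++ rest)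
    word = trans (cong (pre ++_) (trans (cong (_++ rest) eq) (++-assoc u v rest)))
                 (sym (++-assoc pre u (v ++ rest)))

-- The last column of the top row, in which a row placed on top of it would start.
startColumn : ∀ {m} → ℕ → Vec ℕ m → ℕ
startColumn a α = head (ribbonInner (a ∷ α)) + a ∸ 1

StartsIn : ∀ {m} → (ℕ → Set) → (α : Vec ℕ m) → (Fin m → ℕ → ℕ) → Set
StartsIn Allowed []      T = ⊤
StartsIn Allowed (a ∷ α) T = Allowed (T zero (startColumn a α))

lookup-zero : ∀ {n} (v : Vec ℕ (suc n)) → lookup v zero ≡ head v
lookup-zero (x ∷ v) = refl

Cell-first : ∀ {m} a b (α : Vec ℕ m) → 1 ≤ b →
             Cell (ribbon (a ∷ b ∷ α)) (suc zero) (startColumn b α)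
Cell-first a (suc b) α 1≤b
  rewrite Vec.lookup-zipWith _+_ zero (ribbonInner (suc b ∷ α)) (suc b ∷ α)
        | lookup-zero (ribbonInner (suc b ∷ α)) | +-suc (head (ribbonInner (suc b ∷ α))) b =
  m≤m+n _ b , ≤-refl

-- The word `pre` of the rows already read has the current shape as its content; the whole word `w`
-- is fixed throughout, so its properties need not be split.
chain-of-filling : ∀ {m N w} {Allowed : ℕ → Set} (α : Vec ℕ m) (T : Fin m → ℕ → ℕ) pre →
  (∀ k → 1 ≤ lookup α k) → Semistandard (ribbon α) T →
  w ≡ pre ++ reverseReading (ribbon α) T → Yamanouchi w → (∀ k → N ≤ k → occurrences k w ≡ 0) →
  StartsIn Allowed α T → Chain N Allowed (λ k → occurrences k pre) α (λ k → occurrences k w)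
chain-of-filling [] T pre 1≤α ss refl yam out starts k =
  cong (occurrences k) (sym (++-identityʳ pre))
chain-of-filling (zero ∷ α) T pre 1≤α ss eq yam out starts = contradiction (1≤α zero) λ ()
chain-of-filling (suc a ∷ []) T pre 1≤α ss eq yam out starts =
  _ , _ , step-of-row pre (T zero) a [] eq
            (λ t<u u<a → Semistandard.rows-weak ss zero (z≤n , <-trans t<u u<a) (z≤n , u<a) t<u)
            yam out starts
  , λ k → cong (occurrences k) (sym (trans eq (cong (pre ++_) (++-identityʳ _))))
chain-of-filling {Allowed = Allowed} (suc a ∷ b ∷ α) T pre 1≤α ss eq yam out starts =
  _ , _ , step-of-row pre f a (reverseReading (ribbon (b ∷ α)) (T ∘ suc)) eq′
            (λ {t} {u} t<u u<a → Semistandard.rows-weak ss zero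
              (m≤m+n x t , +-monoʳ-< x (<-trans t<u u<a)) (m≤m+n x u , +-monoʳ-< x u<a) (+-monoʳ-< x t<u))
            yam out (subst (λ j → Allowed (T zero j)) (cong (_∸ 1) (+-suc x a)) starts)
  , chain-of-filling (b ∷ α) (T ∘ suc) (pre ++ rowWord f (suc a)) (1≤α ∘ suc) tail-ss
      (trans eq′ (sym (++-assoc pre (rowWord f (suc a)) _))) yam out
      -- The leftmost entry `f 0` stands directly above the rightmost entry of the next row, so it
      -- is the smaller entry that `After` asks for.
      (f 0 , subst (λ j → T zero j < T (suc zero) x) (sym (+-identityʳ x))
               (Semistandard.columns-strict ss x (≤-refl , m<m+n x (s≤s z≤n)) (Cell-first (suc a) b α (1≤α (suc zero))) (s≤s z≤n))
           , occurrences-some f (suc a) (s≤s z≤n))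
  where
  x : ℕ
  x = startColumn b α

  f : ℕ → ℕ
  f t = T zero (x + t)

  eq′ = trans eq (cong (pre ++_) (reverseReading-∷ x (suc a) (ribbonInner (b ∷ α)) (b ∷ α) T))

  tail-ss : Semistandard (ribbon (b ∷ α)) (T ∘ suc)
  tail-ss = record
    { rows-weak      = λ i → Semistandard.rows-weak ss (suc i)
    ; columns-strict = λ j c c′ i<i′ → Semistandard.columns-strict ss j c c′ (s≤s i<i′)
    }

-- From chains to fillings.

value : ℕ → (ℕ → ℕ) → ℕ → ℕ
-- The entry at position `t` of the weakly increasing row with `d k` copies of each `k` below the
-- bound. Positions past the end get the greatest value available, or 0 if there is none.
value zero    d t = 0
value (suc N) d t with t <? sumBelow N d
... | yes _ = value N d t
... | no  _ = N

value-< : ∀ N d {t} → t < sumBelow N d → value (suc N) d t ≡ value N d t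
value-< N d {t} t<S with t <? sumBelow N d
... | yes _   = refl
... | no  t≮S = contradiction t<S t≮S

value-≥ : ∀ N d {t} → sumBelow N d ≤ t → value (suc N) d t ≡ N
value-≥ N d {t} S≤t with t <? sumBelow N d
... | yes t<S = contradiction t<S (≤⇒≯ S≤t)
... | no  _   = refl

value-bound : ∀ N d {t} → t < sumBelow N d → value N d t < N
value-bound (suc N) d {t} t<S with t <? sumBelow N d
... | yes t<S′ = m≤n⇒m≤1+n (value-bound N d t<S′)
... | no  _    = ≤-refl

value-mono : ∀ N d {t u} → t ≤ u → u < sumBelow N d → value N d t ≤ value N d u
value-mono (suc N) d {t} {u} t≤u u<S with t <? sumBelow N d | u <? sumBelow N d
... | yes _   | yes u<S′ = value-mono N d t≤u u<S′
... | yes t<S | no  _    = <⇒≤ (value-bound N d t<S)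
... | no  t≮S | yes u<S′ = contradiction (≤-<-trans t≤u u<S′) t≮S
... | no  _   | no  _    = ≤-refl

rowWord-cong : ∀ {f g} a → (∀ t → t < a → f t ≡ g t) → rowWord f a ≡ rowWord g a
rowWord-cong zero    eq = refl
rowWord-cong (suc a) eq = cong₂ _∷_ (eq a ≤-refl) (rowWord-cong a λ t t<a → eq t (m≤n⇒m≤1+n t<a))

occurrences-value-≥ : ∀ N d k → N ≤ k → occurrences k (rowWord (value N d) (sumBelow N d)) ≡ 0
occurrences-value-≥ N d k N≤k = occurrences-none (value N d) (sumBelow N d)
  λ t t<S → >⇒≢ (<-≤-trans (value-bound N d t<S) N≤k)

occurrences-value-suc : ∀ N d k c →
  occurrences k (rowWord (value (suc N) d) (sumBelow N d + c))
    ≡ c * δ N k + occurrences k (rowWord (value N d) (sumBelow N d))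
occurrences-value-suc N d k zero rewrite +-identityʳ (sumBelow N d) =
  cong (occurrences k) (rowWord-cong (sumBelow N d) λ t t<S → value-< N d t<S)
occurrences-value-suc N d k (suc c)
  rewrite +-suc (sumBelow N d) c
        | occurrences-∷ k (value (suc N) d (sumBelow N d + c)) (rowWord (value (suc N) d) (sumBelow N d + c))
        | value-≥ N d (m≤m+n (sumBelow N d) c) | occurrences-value-suc N d k c =
  sym (+-assoc (δ N k) (c * δ N k) _)

occurrences-value : ∀ N d k → k < N → occurrences k (rowWord (value N d) (sumBelow N d)) ≡ d k
occurrences-value (suc N) d k k<1+N with k ≟ N
... | yes refl = trans (occurrences-value-suc N d N (d N))
  (trans (cong₂ _+_ (trans (cong (d N *_) (δ-same N)) (*-identityʳ (d N))) (occurrences-value-≥ N d N ≤-refl))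
         (+-identityʳ (d N)))
... | no  k≢N  = trans (occurrences-value-suc N d k (d N))
  (cong₂ _+_ (trans (cong (d N *_) (δ-diff (≢-sym k≢N))) (*-zeroʳ (d N)))
             (occurrences-value N d k (≤∧≢⇒< (s≤s⁻¹ k<1+N) k≢N)))

module _ {N : ℕ} {Allowed : ℕ → Set} {σ : ℕ → ℕ} {a : ℕ} {d σ′ : ℕ → ℕ}
         (st : Step N Allowed σ a d σ′) where

  stepRow : List ℕ
  stepRow = rowWord (value N d) a

  occurrences-stepRow : ∀ k → occurrences k stepRow ≡ d k
  occurrences-stepRow k rewrite sym (size st) with k <? N
  ... | yes k<N = occurrences-value N d k k<N
  ... | no  k≮N = trans (occurrences-value-≥ N d k (≮⇒≥ k≮N)) (sym (bounded st k (≮⇒≥ k≮N)))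

  stepRow-mono : ∀ {t u} → t ≤ u → u < a → value N d t ≤ value N d u
  stepRow-mono t≤u u<a = value-mono N d t≤u (subst (_ <_) (sym (size st)) u<a)

  stepRow-range : ∀ {k} → 0 < d k → value N d 0 ≤ k × k ≤ value N d (a ∸ 1)
  stepRow-range {k} 0<dk
    with occurrences-position (value N d) a (subst (0 <_) (sym (occurrences-stepRow k)) 0<dk)
  ... | t , t<a , refl = stepRow-mono z≤n t<a , stepRow-mono (∸-monoˡ-≤ 1 t<a) a∸1<a
    where
    a∸1<a : a ∸ 1 < a
    a∸1<a = ≤-reflexive (m+[n∸m]≡n (≤-trans (s≤s z≤n) t<a))

  occurrences-after : ∀ pre → (∀ k → occurrences k pre ≡ σ k) →
                      ∀ k → occurrences k (pre ++ stepRow) ≡ σ′ k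
  occurrences-after pre content k = trans (occurrences-++ k pre stepRow)
    (trans (cong₂ _+_ (content k) (occurrences-stepRow k)) (sym (grow st k)))

  Yamanouchi-after : ∀ pre → (∀ k → occurrences k pre ≡ σ k) → Yamanouchi pre → Yamanouchi (pre ++ stepRow)
  Yamanouchi-after pre content yam = Yamanouchi-++ pre stepRow yam λ k →
    ≤-trans (≤-reflexive (trans (sym (occurrences-++ (suc k) pre stepRow)) (occurrences-after pre content (suc k))))
            (≤-trans (strip st k) (≤-reflexive (sym (content k))))

prepend : ∀ {m} → (ℕ → ℕ) → (Fin m → ℕ → ℕ) → Fin (suc m) → ℕ → ℕ
prepend f T zero    = f
prepend f T (suc i) = T i

-- Weaker than `StartsIn`: the descent of a strip need not be its lowest cell, so the rightmost
-- entry is only known to be at least an allowed value.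
StartsAbove : ∀ {m} → (ℕ → Set) → (α : Vec ℕ m) → (Fin m → ℕ → ℕ) → Set
StartsAbove Allowed []      T = ⊤
StartsAbove Allowed (a ∷ α) T = ∃[ s ] (s ≤ T zero (startColumn a α) × Allowed s)

-- Consecutive rows share one column and are nonempty, so going down the right ends never move to
-- the right. The `suc` is there because `outer` is an exclusive bound.
outer-below : ∀ {m} a (α : Vec ℕ m) → (∀ k → 1 ≤ lookup α k) → ∀ i →
  lookup (SkewShape.outer (ribbon (a ∷ α))) (suc i) ≤ suc (head (ribbonInner (a ∷ α)))
outer-below a (b ∷ β) 1≤α zero
  rewrite Vec.lookup-zipWith _+_ zero (ribbonInner (b ∷ β)) (b ∷ β) | lookup-zero (ribbonInner (b ∷ β)) =
  m≤n+m∸n (head (ribbonInner (b ∷ β)) + b) 1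
outer-below a (b ∷ β) 1≤α (suc i) =
  ≤-trans (outer-below b β (1≤α ∘ suc) i)
          (s≤s (∸-monoˡ-≤ 1 (≤-trans (≤-reflexive (+-comm 1 _)) (+-monoʳ-≤ _ (1≤α zero)))))

prepend-semistandard : ∀ {m} a b (α : Vec ℕ m) (v : ℕ → ℕ) T →
  (∀ k → 2 ≤ lookup (b ∷ α) k) → (∀ {t u} → t ≤ u → u < a → v t ≤ v u) →
  Semistandard (ribbon (b ∷ α)) T → v 0 < T zero (startColumn b α) →
  Semistandard (ribbon (a ∷ b ∷ α)) (prepend (λ j → v (j ∸ startColumn b α)) T)
prepend-semistandard {m} a b α v T 2≤α v-mono ss v0< = record { rows-weak = rows ; columns-strict = columns }
  where
  x = startColumn b α
  S = ribbon (a ∷ b ∷ α)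
  T′ = prepend (λ j → v (j ∸ x)) T

  rows : ∀ i {j j′} → Cell S i j → Cell S i j′ → j < j′ → T′ i j ≤ T′ i j′
  rows zero    {j} {j′} _ (x≤j′ , j′<x+a) j<j′ = v-mono (∸-monoˡ-≤ x (<⇒≤ j<j′))
    (+-cancelˡ-< x _ _ (subst (_< x + a) (sym (m+[n∸m]≡n x≤j′)) j′<x+a))
  rows (suc i) = Semistandard.rows-weak ss i

  first : ∀ i j → x ≤ j → Cell (ribbon (b ∷ α)) i j → v (j ∸ x) < T i j
  first zero j x≤j (_ , j<)
    rewrite Vec.lookup-zipWith _+_ zero (ribbonInner (b ∷ α)) (b ∷ α) | lookup-zero (ribbonInner (b ∷ α))
    with ≤-antisym x≤j (∸-monoˡ-≤ 1 j<)
  ... | refl = subst (λ t → v t < T zero x) (sym (n∸n≡0 x)) v0<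
  -- The row beginning with length `b` has at least two boxes, so all rows under it end strictly
  -- left of column `x`.
  first (suc i) j x≤j (_ , j<) = contradiction
    (≤-trans (s≤s x≤j) (≤-trans j< (outer-below b α (λ k → <⇒≤ (2≤α (suc k))) i)))
    (<⇒≱ (s≤s (∸-monoˡ-≤ 1 (≤-trans (≤-reflexive (+-comm 2 _)) (+-monoʳ-≤ (head (ribbonInner (b ∷ α))) (2≤α zero))))))

  columns : ∀ {i i′} j → Cell S i j → Cell S i′ j → i Fin.< i′ → T′ i j < T′ i′ j
  columns {zero}  {suc i′} j (x≤j , _) c′ _   = first i′ j x≤j c′
  columns {suc i} {suc i′} j c c′ (s≤s i<i′) = Semistandard.columns-strict ss j c c′ i<i′

-- The filling is built from the bottom row up, before the rows above are known; `pre` stands for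
-- any word they may give, of which only the content and the Yamanouchi property matter.
filling-of-chain : ∀ {m N Allowed σ ν} (α : Vec ℕ m) → (∀ k → 2 ≤ lookup α k) → Chain N Allowed σ α ν →
  ∃[ T ] (Semistandard (ribbon α) T × StartsAbove Allowed α T
    × (∀ pre → (∀ k → occurrences k pre ≡ σ k) → Yamanouchi pre →
         Yamanouchi (pre ++ reverseReading (ribbon α) T)
           × (∀ k → occurrences k (pre ++ reverseReading (ribbon α) T) ≡ ν k)))
filling-of-chain [] 2≤α end = (λ _ _ → 0)
  , record { rows-weak = λ () ; columns-strict = λ { {()} } } , tt
  , λ pre content yam → subst Yamanouchi (sym (++-identityʳ pre)) yam
      , λ k → trans (cong (occurrences k) (++-identityʳ pre)) (trans (content k) (end k))
filling-of-chain {N = N} (a ∷ []) 2≤α (d , σ′ , st , end) with descent st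
... | s , 0<ds , allowed = (λ _ → value N d)
  , record { rows-weak = λ { zero (_ , _) (_ , j′<a) j<j′ → stepRow-mono st (<⇒≤ j<j′) j′<a }
           ; columns-strict = λ { {zero} {zero} _ _ _ () } }
  , (s , proj₂ (stepRow-range st 0<ds) , allowed)
  , λ pre content yam →
      subst Yamanouchi (cong (pre ++_) (sym (++-identityʳ _))) (Yamanouchi-after st pre content yam)
      , λ k → trans (cong (occurrences k) (cong (pre ++_) (++-identityʳ _)))
                (trans (occurrences-after st pre content k) (end k))
filling-of-chain {N = N} {ν = ν} (a ∷ b ∷ α) 2≤α (d , σ′ , st , chain)
  with filling-of-chain (b ∷ α) (2≤α ∘ suc) chain | descent st
... | T , ss , (s , s≤T , t , t<s , 0<dt) , reading | u , 0<du , allowed =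
  T′ , prepend-semistandard a b α (value N d) T (2≤α ∘ suc) (stepRow-mono st) ss
         -- The first entry of the new row is at most `t`, and `t < s` while `s` is at most the
         -- entry below it.
         (≤-<-trans (proj₁ (stepRow-range st 0<dt)) (<-≤-trans t<s s≤T))
     , (u , ≤-trans (proj₂ (stepRow-range st 0<du)) (≤-reflexive (cong (value N d) (sym last-column))) , allowed)
     , reading′
  where
  x = startColumn b α
  T′ = prepend (λ j → value N d (j ∸ x)) T
  rest = reverseReading (ribbon (b ∷ α)) T

  last-column : x + a ∸ 1 ∸ x ≡ a ∸ 1
  last-column = trans (cong (_∸ x) (+-∸-assoc x (<⇒≤ (2≤α zero)))) (m+n∸m≡n x (a ∸ 1))

  word : ∀ pre → (pre ++ stepRow st) ++ rest ≡ pre ++ reverseReading (ribbon (a ∷ b ∷ α)) T′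
  word pre = trans (++-assoc pre (stepRow st) rest) (cong (pre ++_) (sym
    (trans (reverseReading-∷ x a (ribbonInner (b ∷ α)) (b ∷ α) T′)
           (cong (_++ rest) (rowWord-cong a λ t _ → cong (value N d) (m+n∸m≡n x t))))))

  reading′ : ∀ pre → (∀ k → occurrences k pre ≡ _) → Yamanouchi pre →
    Yamanouchi (pre ++ reverseReading (ribbon (a ∷ b ∷ α)) T′)
      × (∀ k → occurrences k (pre ++ reverseReading (ribbon (a ∷ b ∷ α)) T′) ≡ ν k)
  reading′ pre content yam
    with reading (pre ++ stepRow st) (occurrences-after st pre content) (Yamanouchi-after st pre content yam)
  ... | yam′ , content′ = subst Yamanouchi (word pre) yam′
                        , λ k → trans (cong (occurrences k) (sym (word pre))) (content′ k)

-- The inclusion of supports.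

part-beyond : ∀ ps k → length ps ≤ k → part ps k ≡ 0
part-beyond []       k       _         = refl
part-beyond (p ∷ ps) (suc k) (s≤s len≤k) = part-beyond ps k len≤k

theorem3p3 : ∀ {n} (α : Vec ℕ (suc n)) → 3 ≤ suc n →
    (∀ k → 2 ≤ lookup α k) →
    (i : Fin n) →
    lookup α (suc i) < lookup α (inject₁ i) →
    [ lookup α (inject₁ i) ] <⁺ lookup∞ α (inject₁ (inject₁ i)) +⁺ lookup α (suc i) →
    Support (ribbon α) ⊆ Support (ribbon (swapAdjacent i α))
theorem3p3 {n} α@(a ∷ α₁) _ 2≤α i desc short {ν} (T , lr) = result
  where
  open IsLittlewoodRichardson lr
  -- Every entry is below the number of parts of `ν`, so this bounds the rows of all strips.
  N = length (Partition.parts ν)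

  chain : Chain N (λ _ → ⊤) (λ _ → 0) α _
  chain = chain-of-filling α T [] (λ k → <⇒≤ (2≤α k)) semistandard refl yamanouchi
    (λ k N≤k → trans (content k) (part-beyond (Partition.parts ν) k N≤k)) tt

  lookup∞≡ : ∀ k → lookup∞ α k ≡ lookupAfter ⊤⁺ α k
  lookup∞≡ zero    = refl
  lookup∞≡ (suc k) = refl

  2≤α′ : ∀ k → 2 ≤ lookup (swapAdjacent i α) k
  2≤α′ k = subst (2 ≤_) (sym (Vec.lookup∘tabulate (λ j → lookup α (transpose (inject₁ i) (suc i) j)) k))
                 (2≤α (transpose (inject₁ i) (suc i) k))

  result : Support (ribbon (swapAdjacent i α)) ν
  result with swap-chain [] {λ _ → 0} (λ _ → refl) [] α 2≤α i desc
                (subst (λ p → [ lookup α (inject₁ i) ] <⁺ p +⁺ lookup α (suc i)) (lookup∞≡ (inject₁ (inject₁ i))) short)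
                chain
  ... | _ , σ′ , σ′≡0 , chain′
    with filling-of-chain (swapAdjacent i α) 2≤α′ chain′
  ...   | T′ , ss′ , _ , reading with reading [] (λ k → sym (σ′≡0 k)) yam-[]
    where
    yam-[] : Yamanouchi []
    yam-[] zero    k = z≤n
    yam-[] (suc n) k = z≤n
  ...     | yam′ , content′ = T′ , record
    { semistandard = ss′
    ; yamanouchi   = yam′
    ; content      = λ k → trans (content′ k) (content k)
    }
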